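{- Let $t$ and $u$ be $\lambda$-terms (terms without explicit substitutions). Then $t$ and $u$ are contextually equivalent in $\lambda_{\mathsf{Plot}}$ if and only if they are contextually equivalent in the VSC, that is, $t =_{\mathcal C}^{\lambda_{\mathsf{Plot}}} u$ if and only if $t =_{\mathcal C}^{\mathrm{VSC}} u$.
   Context: Value substitution calculus (VSC). Terms (the set $\Lambda_{\mathsf{vsc}}$) are $t,u,s ::= v \mid tu \mid t[x{\leftarrow}u]$ and values are $v ::= x \mid \lambda x.t$; $t[x{\leftarrow}u]$ is an explicit substitution (ES), binding $x$ in $t$. Terms are identified up to $\alpha$-renaming; $t\{x{\leftarrow}u\}$ is capture-avoiding (meta-level) substitution. Contexts are terms with exactly one hole $\langle\cdot\rangle$; plugging $C\langle t\rangle$ may capture variables. Substitution contexts: $L ::= \langle\cdot\rangle \mid L[x{\leftarrow}t]$. Root rules: $L\langle\lambda x.t\rangle u \mapsto_{\mathsf m} L\langle t[x{\leftarrow}u]\rangle$ and $t[x{\leftarrow}L\langle v\rangle] \mapsto_{\mathsf e} L\langle t\{x{\leftarrow}v\}\rangle$ with $v$ a value, where (by $\alpha$-renaming) $L$ captures no free variable of $u$, resp. of $t$. Full contexts: $F ::= \langle\cdot\rangle \mid Ft \mid tF \mid \lambda x.F \mid F[x{\leftarrow}t] \mid t[x{\leftarrow}F]$. The reduction $\to_{\mathsf{vsc}}$ is the closure of $\mapsto_{\mathsf m}\cup\mapsto_{\mathsf e}$ under full contexts. Plotkin's calculus $\lambda_{\mathsf{Plot}}$. Terms are those of the VSC without ES;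 reduction is the closure under all contexts (without ES) of $(\lambda x.t)v \mapsto t\{x{\leftarrow}v\}$ with $v$ a value (variable or abstraction). Contextual equivalence. For $\mathsf X \in\{\lambda_{\mathsf{Plot}},\mathrm{VSC}\}$ and terms $t,u$ of $\mathsf X$, $t =_{\mathcal C}^{\mathsf X} u$ iff for every context $C$ of $\mathsf X$ such that $C\langle t\rangle$ and $C\langle u\rangle$ are closed: $C\langle t\rangle \to_{\mathsf X}^* v$ for some value $v$ of $\mathsf X$ if and only if $C\langle u\rangle\to_{\mathsf X}^* v'$ for some value $v'$ of $\mathsf X$. -}

module Defs where

open import Data.Bool.Base using (if_then_else_)
open import Data.Nat.Base using (ℕ; zero; suc; _+_)
open import Data.Nat.Properties using (_≟_)
open import Data.Product.Base using (∃-syntax; _×_)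
open import Function.Bundles using (_⇔_)
open import Relation.Nullary.Decidable.Core using (does)
open import Relation.Nullary.Negation.Core using (¬_)
open import Relation.Binary.Construct.Closure.ReflexiveTransitive using (Star)

data Calculus : Set where
  λPlot VSC : Calculus

variable
  X : Calculus

-- Terms up to α-renaming, as de Bruijn terms: `lam t` and `es t u` (the
-- explicit substitution t[x←u]) bind index 0 of t.  The free indices of a
-- top-level term play the role of its free variable names, so the set of
-- names is ℕ.  Explicit substitutions exist only in the VSC.
data Tm : Calculus → Set where
  var : ℕ → Tm X
  lam : Tm X → Tm X
  app : Tm X → Tm X → Tm X
  es  : Tm VSC → Tm VSC → Tm VSC

data Value : Tm X → Set where
  var : (x : ℕ) → Value {X} (var x)
  lam : (t : Tm X) → Value (lam t)

embed : Tm λPlot → Tm VSC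
embed (var x)   = var x
embed (lam t)   = lam (embed t)
embed (app t u) = app (embed t) (embed u)

-- `x ∈fv t`: the index x, counted from outside t, is free in t.
data _∈fv_ : ℕ → Tm X → Set where
  var  : ∀ {x} → _∈fv_ {X} x (var x)
  lam  : ∀ {x} {t : Tm X} → suc x ∈fv t → x ∈fv lam t
  appˡ : ∀ {x} {t u : Tm X} → x ∈fv t → x ∈fv app t u
  appʳ : ∀ {x} {t u : Tm X} → x ∈fv u → x ∈fv app t u
  esˡ  : ∀ {x t u} → suc x ∈fv t → x ∈fv es t u
  esʳ  : ∀ {x t u} → x ∈fv u → x ∈fv es t u

Closed : Tm X → Set
Closed t = ∀ x → ¬ (x ∈fv t)

lift : (ℕ → ℕ) → ℕ → ℕ
lift ρ zero    = zero
lift ρ (suc x) = suc (ρ x)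

rename : (ℕ → ℕ) → Tm X → Tm X
rename ρ (var x)   = var (ρ x)
rename ρ (lam t)   = lam (rename (lift ρ) t)
rename ρ (app t u) = app (rename ρ t) (rename ρ u)
rename ρ (es t u)  = es (rename (lift ρ) t) (rename ρ u)

lifts : (ℕ → Tm X) → ℕ → Tm X
lifts σ zero    = var zero
lifts σ (suc x) = rename suc (σ x)

subst : (ℕ → Tm X) → Tm X → Tm X
subst σ (var x)   = σ x
subst σ (lam t)   = lam (subst (lifts σ) t)
subst σ (app t u) = app (subst σ t) (subst σ u)
subst σ (es t u)  = es (subst (lifts σ) t) (subst σ u)

single : Tm X → ℕ → Tm X
single u zero    = u
single u (suc x) = var x

-- t{x←u}, where x is index 0 of t.
_⟦_⟧ : Tm X → Tm X → Tm X
t ⟦ u ⟧ = subst (single u) t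

-- Substitution contexts.  The binders of L scope over the hole, so plugging
-- into L without any adjustment lets them capture the indices below `depth L`.
data SubCtx : Set where
  ∙     : SubCtx
  _[←_] : SubCtx → Tm VSC → SubCtx

_⟪_⟫ : SubCtx → Tm VSC → Tm VSC
∙         ⟪ t ⟫ = t
(L [← s ]) ⟪ t ⟫ = es (L ⟪ t ⟫) s

depth : SubCtx → ℕ
depth ∙         = zero
depth (L [← _ ]) = suc (depth L)

-- The side condition that L captures no free variable of u (resp. t) becomes
-- a renaming of u (resp. t, except for its bound index 0) past the binders of L.
data Root : (X : Calculus) → Tm X → Tm X → Set where
  βᵥ : ∀ {t v} → Value v → Root λPlot (app (lam t) v) (t ⟦ v ⟧)
  m  : ∀ L {t u} →
       Root VSC (app (L ⟪ lam t ⟫) u) (L ⟪ es t (rename (depth L +_) u) ⟫)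
  e  : ∀ L {t v} → Value v →
       Root VSC (es t (L ⟪ v ⟫)) (L ⟪ rename (lift (depth L +_)) t ⟦ v ⟧ ⟫)

-- Closure of the root rules under all contexts of the calculus.
data _⟶_ : Tm X → Tm X → Set where
  root : ∀ {t t′ : Tm X} → Root X t t′ → t ⟶ t′
  lam  : ∀ {t t′ : Tm X} → t ⟶ t′ → lam t ⟶ lam t′
  appˡ : ∀ {t t′ u : Tm X} → t ⟶ t′ → app t u ⟶ app t′ u
  appʳ : ∀ {t u u′ : Tm X} → u ⟶ u′ → app t u ⟶ app t u′
  esˡ  : ∀ {t t′ u} → t ⟶ t′ → es t u ⟶ es t′ u
  esʳ  : ∀ {t u u′} → u ⟶ u′ → es t u ⟶ es t u′

_⟶*_ : Tm X → Tm X → Set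
_⟶*_ = Star _⟶_

-- `bind x t` is the body of an abstraction of the name x in t: x becomes
-- index 0 and every other name y is still y outside of the new binder.
bindVar : ℕ → ℕ → ℕ
bindVar x y = if does (x ≟ y) then zero else suc y

bind : ℕ → Tm X → Tm X
bind x = rename (bindVar x)

-- Contexts with named binders: since the binder names are part of the context,
-- plugging captures the free variables having those names, whatever the number
-- and the order of the binders.
data Ctx : Calculus → Set where
  ∙    : Ctx X
  lam  : ℕ → Ctx X → Ctx X
  appˡ : Ctx X → Tm X → Ctx X
  appʳ : Tm X → Ctx X → Ctx X
  esˡ  : Ctx VSC → ℕ → Tm VSC → Ctx VSC
  esʳ  : Tm VSC → ℕ → Ctx VSC → Ctx VSC

_⟨_⟩ : Ctx X → Tm X → Tm X
∙         ⟨ t ⟩ = t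
lam x C   ⟨ t ⟩ = lam (bind x (C ⟨ t ⟩))
appˡ C u  ⟨ t ⟩ = app (C ⟨ t ⟩) u
appʳ u C  ⟨ t ⟩ = app u (C ⟨ t ⟩)
esˡ C x u ⟨ t ⟩ = es (bind x (C ⟨ t ⟩)) u
esʳ u x C ⟨ t ⟩ = es (bind x u) (C ⟨ t ⟩)

_⇓ : Tm X → Set
t ⇓ = ∃[ v ] Value v × t ⟶* v

CtxEquiv : (X : Calculus) → Tm X → Tm X → Set
CtxEquiv X t u = (C : Ctx X) → Closed (C ⟨ t ⟩) → Closed (C ⟨ u ⟩) →
                 (C ⟨ t ⟩) ⇓ ⇔ (C ⟨ u ⟩) ⇓

{-# OPTIONS --safe #-}
-- Weak call-by-value big-step evaluation, with an explicit substitution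
-- evaluated like a β-redex, is sound for both calculi.  It is also complete for
-- the full reduction of the VSC: write t ≼ u when, under every substitution of
-- values, t evaluates to each value to which u evaluates.  Both root rules are
-- contained in ≼, so every reduction step is contained in the Howe-style
-- closure ≼ᴴ of ≼ (≼ on the outside, then recursively on the immediate
-- subterms), and ≼ᴴ reflects evaluation.  Reading es t u as (λ t) u thus
-- preserves and reflects convergence of VSC terms, and it commutes with
-- plugging into contexts.
module Submission where

open import Defs
open import Data.Nat.Base using (ℕ; zero; suc; _+_)
open import Data.Nat.Properties using (+-suc)
open import Data.Product.Base using (∃-syntax; _×_; _,_)
open import Function.Base using (_∘_; id)
open import Function.Bundles using (_⇔_; mk⇔; module Equivalence)
open import Function.Properties.Equivalence using (⇔-setoid)
open import Level using (0ℓ)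
open import Relation.Binary.Bundles using (Setoid)
open import Relation.Binary.Construct.Closure.ReflexiveTransitive
  using (ε; _◅_; _◅◅_; gmap; kleisliStar)
open import Relation.Binary.PropositionalEquality
  using (_≡_; _≗_; refl; sym; trans; cong; cong₂; module ≡-Reasoning)
  renaming (subst to transport)

private
  variable
    t t′ u u′ v w : Tm X

-- Renaming and substitution

lift-cong : ∀ {ρ ρ′} → ρ ≗ ρ′ → lift ρ ≗ lift ρ′
lift-cong eq zero    = refl
lift-cong eq (suc x) = cong suc (eq x)

rename-cong : ∀ {ρ ρ′} → ρ ≗ ρ′ → rename {X} ρ ≗ rename ρ′
rename-cong eq (var x)   = cong var (eq x)
rename-cong eq (lam t)   = cong lam (rename-cong (lift-cong eq) t)
rename-cong eq (app t u) = cong₂ app (rename-cong eq t) (rename-cong eq u)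
rename-cong eq (es t u)  = cong₂ es (rename-cong (lift-cong eq) t) (rename-cong eq u)

lifts-cong : {σ τ : ℕ → Tm X} → σ ≗ τ → lifts σ ≗ lifts τ
lifts-cong eq zero    = refl
lifts-cong eq (suc x) = cong (rename suc) (eq x)

subst-cong : {σ τ : ℕ → Tm X} → σ ≗ τ → subst σ ≗ subst τ
subst-cong eq (var x)   = eq x
subst-cong eq (lam t)   = cong lam (subst-cong (lifts-cong eq) t)
subst-cong eq (app t u) = cong₂ app (subst-cong eq t) (subst-cong eq u)
subst-cong eq (es t u)  = cong₂ es (subst-cong (lifts-cong eq) t) (subst-cong eq u)

lifts-var : lifts {X} var ≗ var
lifts-var zero    = refl
lifts-var (suc x) = refl

subst-var : subst {X} var ≗ id
subst-var (var x)   = refl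
subst-var (lam t)   = cong lam (trans (subst-cong lifts-var t) (subst-var t))
subst-var (app t u) = cong₂ app (subst-var t) (subst-var u)
subst-var (es t u)  = cong₂ es (trans (subst-cong lifts-var t) (subst-var t)) (subst-var u)

lifts-∘-lift : (σ : ℕ → Tm X) (ρ : ℕ → ℕ) → lifts σ ∘ lift ρ ≗ lifts (σ ∘ ρ)
lifts-∘-lift σ ρ zero    = refl
lifts-∘-lift σ ρ (suc x) = refl

subst-rename : (σ : ℕ → Tm X) (ρ : ℕ → ℕ) → subst σ ∘ rename ρ ≗ subst (σ ∘ ρ)
subst-rename σ ρ (var x)   = refl
subst-rename σ ρ (lam t)   = cong lam
  (trans (subst-rename (lifts σ) (lift ρ) t) (subst-cong (lifts-∘-lift σ ρ) t))
subst-rename σ ρ (app t u) = cong₂ app (subst-rename σ ρ t) (subst-rename σ ρ u)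
subst-rename σ ρ (es t u)  = cong₂ es
  (trans (subst-rename (lifts σ) (lift ρ) t) (subst-cong (lifts-∘-lift σ ρ) t))
  (subst-rename σ ρ u)

lifts-var∘ : (ρ : ℕ → ℕ) → lifts {X} (var ∘ ρ) ≗ var ∘ lift ρ
lifts-var∘ ρ zero    = refl
lifts-var∘ ρ (suc x) = refl

rename-as-subst : (ρ : ℕ → ℕ) → rename {X} ρ ≗ subst (var ∘ ρ)
rename-as-subst ρ (var x)   = refl
rename-as-subst ρ (lam t)   = cong lam
  (trans (rename-as-subst (lift ρ) t) (sym (subst-cong (lifts-var∘ ρ) t)))
rename-as-subst ρ (app t u) = cong₂ app (rename-as-subst ρ t) (rename-as-subst ρ u)
rename-as-subst ρ (es t u)  = cong₂ es
  (trans (rename-as-subst (lift ρ) t) (sym (subst-cong (lifts-var∘ ρ) t)))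
  (rename-as-subst ρ u)

rename-id : rename {X} id ≗ id
rename-id t = trans (rename-as-subst id t) (subst-var t)

rename-rename : (ρ′ ρ : ℕ → ℕ) → rename {X} ρ′ ∘ rename ρ ≗ rename (ρ′ ∘ ρ)
rename-rename ρ′ ρ t = trans (rename-as-subst ρ′ (rename ρ t))
  (trans (subst-rename (var ∘ ρ′) ρ t) (sym (rename-as-subst (ρ′ ∘ ρ) t)))

lifts-rename : (ρ : ℕ → ℕ) (σ : ℕ → Tm X) →
               rename (lift ρ) ∘ lifts σ ≗ lifts (rename ρ ∘ σ)
lifts-rename ρ σ zero    = refl
lifts-rename ρ σ (suc x) =
  trans (rename-rename (lift ρ) suc (σ x)) (sym (rename-rename suc ρ (σ x)))

rename-subst : (ρ : ℕ → ℕ) (σ : ℕ → Tm X) → rename ρ ∘ subst σ ≗ subst (rename ρ ∘ σ)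
rename-subst ρ σ (var x)   = refl
rename-subst ρ σ (lam t)   = cong lam
  (trans (rename-subst (lift ρ) (lifts σ) t) (subst-cong (lifts-rename ρ σ) t))
rename-subst ρ σ (app t u) = cong₂ app (rename-subst ρ σ t) (rename-subst ρ σ u)
rename-subst ρ σ (es t u)  = cong₂ es
  (trans (rename-subst (lift ρ) (lifts σ) t) (subst-cong (lifts-rename ρ σ) t))
  (rename-subst ρ σ u)

lifts-subst : (τ σ : ℕ → Tm X) → subst (lifts τ) ∘ lifts σ ≗ lifts (subst τ ∘ σ)
lifts-subst τ σ zero    = refl
lifts-subst τ σ (suc x) =
  trans (subst-rename (lifts τ) suc (σ x)) (sym (rename-subst suc τ (σ x)))

subst-subst : (τ σ : ℕ → Tm X) → subst τ ∘ subst σ ≗ subst (subst τ ∘ σ)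
subst-subst τ σ (var x)   = refl
subst-subst τ σ (lam t)   = cong lam
  (trans (subst-subst (lifts τ) (lifts σ) t) (subst-cong (lifts-subst τ σ) t))
subst-subst τ σ (app t u) = cong₂ app (subst-subst τ σ t) (subst-subst τ σ u)
subst-subst τ σ (es t u)  = cong₂ es
  (trans (subst-subst (lifts τ) (lifts σ) t) (subst-cong (lifts-subst τ σ) t))
  (subst-subst τ σ u)

infixr 5 _•_

_•_ : Tm X → (ℕ → Tm X) → ℕ → Tm X
(w • σ) zero    = w
(w • σ) (suc x) = σ x

-- Evaluation fills a binder with `w` after `σ` has passed under it. Fusing the two lets inductions
-- on `L` treat an evaluated ES as an extension of the substitution.
subst-lifts-⟦⟧ : (σ : ℕ → Tm X) (t w : Tm X) → subst (lifts σ) t ⟦ w ⟧ ≡ subst (w • σ) t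
subst-lifts-⟦⟧ σ t w = trans (subst-subst (single w) (lifts σ) t) (subst-cong pointwise t)
  where
  pointwise : subst (single w) ∘ lifts σ ≗ w • σ
  pointwise zero    = refl
  pointwise (suc x) = trans (subst-rename (single w) suc (σ x)) (subst-var (σ x))

subst-⟦⟧ : (σ : ℕ → Tm X) (t u : Tm X) → subst σ (t ⟦ u ⟧) ≡ subst (subst σ u • σ) t
subst-⟦⟧ σ t u = trans (subst-subst σ (single u) t) (subst-cong pointwise t)
  where
  pointwise : subst σ ∘ single u ≗ subst σ u • σ
  pointwise zero    = refl
  pointwise (suc x) = refl

-- Weakening is split into one binder, that of the outermost ES, and `n` more, which is the form
-- required by the induction on `L`.
rename-lift-+ : ∀ n (t : Tm X) →
                rename (lift (suc n +_)) t ≡ rename (lift (n +_)) (rename (lift suc) t)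
rename-lift-+ n t = trans (rename-cong pointwise t) (sym (rename-rename _ _ t))
  where
  pointwise : lift (suc n +_) ≗ lift (n +_) ∘ lift suc
  pointwise zero    = refl
  pointwise (suc x) = cong suc (sym (+-suc n x))

rename-+ : ∀ n (t : Tm X) → rename (suc n +_) t ≡ rename (n +_) (rename suc t)
rename-+ n t = trans (rename-cong (λ x → sym (+-suc n x)) t) (sym (rename-rename _ _ t))

-- Values

ValueSubst : (ℕ → Tm X) → Set
ValueSubst σ = ∀ x → Value (σ x)

rename-value : ∀ ρ → Value v → Value (rename ρ v)
rename-value ρ (var x) = var (ρ x)
rename-value ρ (lam t) = lam _

lifts-value : {σ : ℕ → Tm X} → ValueSubst σ → ValueSubst (lifts σ)
lifts-value vσ zero    = var zero
lifts-value vσ (suc x) = rename-value suc (vσ x)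

subst-value : {σ : ℕ → Tm X} → ValueSubst σ → Value v → Value (subst σ v)
subst-value vσ (var x) = vσ x
subst-value vσ (lam t) = lam _

single-value : Value v → ValueSubst (single v)
single-value vv zero    = vv
single-value vv (suc x) = var x

•-value : {σ : ℕ → Tm X} → Value v → ValueSubst σ → ValueSubst (v • σ)
•-value vv vσ zero    = vv
•-value vv vσ (suc x) = vσ x

-- Big-step evaluation

infix 4 _⇩_

data _⇩_ : Tm X → Tm X → Set where
  val : {v : Tm X} → Value v → v ⇩ v
  app : {t u b w v : Tm X} → t ⇩ lam b → u ⇩ w → b ⟦ w ⟧ ⇩ v → app t u ⇩ v
  es  : ∀ {t u w v} → u ⇩ w → t ⟦ w ⟧ ⇩ v → es t u ⇩ v

⇩-value : t ⇩ v → Value v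
⇩-value (val vv)    = vv
⇩-value (app _ _ d) = ⇩-value d
⇩-value (es _ d)    = ⇩-value d

value-⇩ : Value v → v ⇩ w → v ≡ w
value-⇩ _  (val _)       = refl
value-⇩ () (app _ _ _)
value-⇩ () (es _ _)

-- Soundness of evaluation for reduction

m-∙-⟶ : ∀ t u → app (lam t) u ⟶ es t u
m-∙-⟶ t u = transport (app (lam t) u ⟶_) (cong (es t) (rename-id u)) (root (m ∙))

rename-lift-id : rename {X} (lift id) ≗ id
rename-lift-id t = trans (rename-cong (λ { zero → refl ; (suc x) → refl }) t) (rename-id t)

e-∙-⟶ : ∀ t → Value v → es t v ⟶ (t ⟦ v ⟧)
e-∙-⟶ {v = v} t vv =
  transport (es t v ⟶_) (cong (_⟦ v ⟧) (rename-lift-id t)) (root (e ∙ vv))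

-- In the VSC a β-step splits into an `m` step and an `e` step, both with the empty substitution
-- context.
β-⟶* : ∀ {X} {v : Tm X} t → Value v → app (lam t) v ⟶* (t ⟦ v ⟧)
β-⟶* {λPlot} t vv = root (βᵥ vv) ◅ ε
β-⟶* {VSC}   t vv = m-∙-⟶ t _ ◅ e-∙-⟶ t vv ◅ ε

⇩-reduces : t ⇩ v → t ⟶* v
⇩-reduces (val _) = ε
⇩-reduces (app d₁ d₂ d₃) =
  gmap (λ t → app t _) appˡ (⇩-reduces d₁) ◅◅
  gmap (app _) appʳ (⇩-reduces d₂) ◅◅
  β-⟶* _ (⇩-value d₂) ◅◅ ⇩-reduces d₃
⇩-reduces (es d₁ d₂) =
  gmap (es _) esʳ (⇩-reduces d₁) ◅◅
  e-∙-⟶ _ (⇩-value d₁) ◅ ⇩-reduces d₂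

⇩⇒⇓ : t ⇩ v → t ⇓
⇩⇒⇓ d = _ , ⇩-value d , ⇩-reduces d

-- The Kleene order

infix 4 _≼_ _≼ᴴ_

-- Value substitutions are the right ones to quantify over because evaluation substitutes values
-- only. The record, unlike a bare function type, lets `t` and `u` be inferred from a proof.
record _≼_ (t u : Tm VSC) : Set where
  constructor kleene
  field
    subst-⇩ : ∀ {σ v} → ValueSubst σ → subst σ u ⇩ v → subst σ t ⇩ v

open _≼_

≼-refl : t ≼ t
≼-refl = kleene λ _ d → d

≼-trans : t ≼ u → u ≼ w → t ≼ w
≼-trans p q = kleene λ vσ d → subst-⇩ p vσ (subst-⇩ q vσ d)

-- Take the identity substitution, which qualifies because variables are values.
≼-⇩ : t ≼ u → u ⇩ v → t ⇩ v
≼-⇩ {t} {u} p d = transport (_⇩ _) (subst-var t)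
  (subst-⇩ p var (transport (_⇩ _) (sym (subst-var u)) d))

≼-subst : ∀ {σ} → ValueSubst σ → t ≼ u → subst σ t ≼ subst σ u
≼-subst {t} {u} {σ} vσ p = kleene λ {τ} vτ d →
  transport (_⇩ _) (sym (subst-subst τ σ t))
    (subst-⇩ p (λ x → subst-value vτ (vσ x)) (transport (_⇩ _) (subst-subst τ σ u) d))

-- Both sides run the same evaluations in the same order: the ESs of `L`, then `u`, then the body.
-- In the induction on `L`, the value of the outermost ES extends `σ`.
m-subst-⇩ : ∀ L t u {σ v} → ValueSubst σ →
            subst σ (L ⟪ es t (rename (depth L +_) u) ⟫) ⇩ v →
            subst σ (app (L ⟪ lam t ⟫) u) ⇩ v
m-subst-⇩ ∙ t u vσ (val ())
m-subst-⇩ ∙ t u vσ (es d₁ d₂) =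
  app (val (lam _)) (transport (λ u′ → subst _ u′ ⇩ _) (rename-id u) d₁) d₂
m-subst-⇩ (L [← s ]) t u vσ (val ())
m-subst-⇩ (L [← s ]) t u {σ} vσ (es {w = w} d₁ d₂)
  with m-subst-⇩ L t (rename suc u) (•-value (⇩-value d₁) vσ)
         (transport (_⇩ _)
           (trans (subst-lifts-⟦⟧ σ (L ⟪ es t (rename (suc (depth L) +_) u) ⟫) w)
                  (cong (λ u′ → subst (w • σ) (L ⟪ es t u′ ⟫)) (rename-+ (depth L) u)))
           d₂)
... | val ()
-- The outermost ES is put back around the function alone; the argument, being weakened, does not
-- see its value `w`.
... | app d₃ d₄ d₅ =
  app (es d₁ (transport (_⇩ _) (sym (subst-lifts-⟦⟧ σ (L ⟪ lam t ⟫) w)) d₃))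
      (transport (_⇩ _) (subst-rename (w • σ) suc u) d₄) d₅

-- The induction is that of `m-subst-⇩`. In the base case `subst σ v` is again a value because `σ`
-- consists of values, so it evaluates to itself.
e-subst-⇩ : ∀ L t v {σ w} → Value v → ValueSubst σ →
            subst σ (L ⟪ rename (lift (depth L +_)) t ⟦ v ⟧ ⟫) ⇩ w →
            subst σ (es t (L ⟪ v ⟫)) ⇩ w
e-subst-⇩ ∙ t v {σ} vv vσ d = es (val (subst-value vσ vv)) (transport (_⇩ _) eq d)
  where
  open ≡-Reasoning
  eq : subst σ (rename (lift id) t ⟦ v ⟧) ≡ subst (lifts σ) t ⟦ subst σ v ⟧
  eq = begin
    subst σ (rename (lift id) t ⟦ v ⟧)  ≡⟨ cong (λ t′ → subst σ (t′ ⟦ v ⟧)) (rename-lift-id t) ⟩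
    subst σ (t ⟦ v ⟧)                   ≡⟨ subst-⟦⟧ σ t v ⟩
    subst (subst σ v • σ) t             ≡⟨ subst-lifts-⟦⟧ σ t (subst σ v) ⟨
    subst (lifts σ) t ⟦ subst σ v ⟧     ∎
e-subst-⇩ (L [← s ]) t v vv vσ (val ())
e-subst-⇩ (L [← s ]) t v {σ} vv vσ (es {w = u} d₁ d₂)
  with e-subst-⇩ L (rename (lift suc) t) v vv (•-value (⇩-value d₁) vσ)
         (transport (_⇩ _)
           (trans (subst-lifts-⟦⟧ σ (L ⟪ rename (lift (suc (depth L) +_)) t ⟦ v ⟧ ⟫) u)
                  (cong (λ t′ → subst (u • σ) (L ⟪ t′ ⟦ v ⟧ ⟫)) (rename-lift-+ (depth L) t)))
           d₂)
... | val ()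
... | es {w = w} d₃ d₄ =
  es (es d₁ (transport (_⇩ _) (sym (subst-lifts-⟦⟧ σ (L ⟪ v ⟫) u)) d₃))
     (transport (_⇩ _) eq d₄)
  where
  eq : subst (lifts (u • σ)) (rename (lift suc) t) ⟦ w ⟧ ≡ subst (lifts σ) t ⟦ w ⟧
  eq = cong (_⟦ w ⟧)
    (trans (subst-rename (lifts (u • σ)) (lift suc) t)
           (subst-cong (lifts-∘-lift (u • σ) suc) t))

Root⇒≼ : Root VSC t t′ → t ≼ t′
Root⇒≼ (m L {t} {u})    = kleene (m-subst-⇩ L t u)
Root⇒≼ (e L {t} {v} vv) = kleene (e-subst-⇩ L t v vv)

es-≼-app : es t u ≼ app (lam t) u
es-≼-app = kleene λ where
  _ (val ())
  _ (app (val _) d₁ d₂) → es d₁ d₂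

-- The Howe closure

-- `≼` itself is not preserved by `lam`, since an abstraction evaluates only to itself; hence the
-- congruence rules. Composing with `≼` on the left of each rule yields `≼-≼ᴴ-trans`, on which the
-- variable case of `≼ᴴ-subst` relies.
data _≼ᴴ_ : Tm VSC → Tm VSC → Set where
  var : ∀ {t x} → t ≼ var x → t ≼ᴴ var x
  lam : ∀ {t t₁ u₁} → t ≼ lam t₁ → t₁ ≼ᴴ u₁ → t ≼ᴴ lam u₁
  app : ∀ {t t₁ t₂ u₁ u₂} → t ≼ app t₁ t₂ → t₁ ≼ᴴ u₁ → t₂ ≼ᴴ u₂ → t ≼ᴴ app u₁ u₂
  es  : ∀ {t t₁ t₂ u₁ u₂} → t ≼ es t₁ t₂ → t₁ ≼ᴴ u₁ → t₂ ≼ᴴ u₂ → t ≼ᴴ es u₁ u₂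

≼ᴴ-refl : ∀ t → t ≼ᴴ t
≼ᴴ-refl (var x)   = var ≼-refl
≼ᴴ-refl (lam t)   = lam ≼-refl (≼ᴴ-refl t)
≼ᴴ-refl (app t u) = app ≼-refl (≼ᴴ-refl t) (≼ᴴ-refl u)
≼ᴴ-refl (es t u)  = es ≼-refl (≼ᴴ-refl t) (≼ᴴ-refl u)

≼-≼ᴴ-trans : t ≼ u → u ≼ᴴ w → t ≼ᴴ w
≼-≼ᴴ-trans p (var q)       = var (≼-trans p q)
≼-≼ᴴ-trans p (lam q h)     = lam (≼-trans p q) h
≼-≼ᴴ-trans p (app q h₁ h₂) = app (≼-trans p q) h₁ h₂
≼-≼ᴴ-trans p (es q h₁ h₂)  = es (≼-trans p q) h₁ h₂

≼⇒≼ᴴ : t ≼ u → t ≼ᴴ u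
≼⇒≼ᴴ p = ≼-≼ᴴ-trans p (≼ᴴ-refl _)

≼-rename : ∀ ρ → t ≼ u → rename ρ t ≼ rename ρ u
≼-rename {t} {u} ρ p
  rewrite rename-as-subst ρ t | rename-as-subst ρ u = ≼-subst (λ x → var (ρ x)) p

≼ᴴ-rename : ∀ ρ → t ≼ᴴ u → rename ρ t ≼ᴴ rename ρ u
≼ᴴ-rename ρ (var p)       = var (≼-rename ρ p)
≼ᴴ-rename ρ (lam p h)     = lam (≼-rename ρ p) (≼ᴴ-rename (lift ρ) h)
≼ᴴ-rename ρ (app p h₁ h₂) = app (≼-rename ρ p) (≼ᴴ-rename ρ h₁) (≼ᴴ-rename ρ h₂)
≼ᴴ-rename ρ (es p h₁ h₂)  = es (≼-rename ρ p) (≼ᴴ-rename (lift ρ) h₁) (≼ᴴ-rename ρ h₂)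

lifts-≼ᴴ : {σ τ : ℕ → Tm VSC} → (∀ x → σ x ≼ᴴ τ x) → ∀ x → lifts σ x ≼ᴴ lifts τ x
lifts-≼ᴴ hσ zero    = ≼ᴴ-refl _
lifts-≼ᴴ hσ (suc x) = ≼ᴴ-rename suc (hσ x)

-- The outer `≼` of each rule is instantiated with `σ`, which is why `σ` has to consist of values.
≼ᴴ-subst : ∀ {σ τ} → ValueSubst σ → (∀ x → σ x ≼ᴴ τ x) → t ≼ᴴ u → subst σ t ≼ᴴ subst τ u
≼ᴴ-subst vσ hσ (var p)       = ≼-≼ᴴ-trans (≼-subst vσ p) (hσ _)
≼ᴴ-subst vσ hσ (lam p h)     =
  lam (≼-subst vσ p) (≼ᴴ-subst (lifts-value vσ) (lifts-≼ᴴ hσ) h)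
≼ᴴ-subst vσ hσ (app p h₁ h₂) =
  app (≼-subst vσ p) (≼ᴴ-subst vσ hσ h₁) (≼ᴴ-subst vσ hσ h₂)
≼ᴴ-subst vσ hσ (es p h₁ h₂)  =
  es (≼-subst vσ p) (≼ᴴ-subst (lifts-value vσ) (lifts-≼ᴴ hσ) h₁) (≼ᴴ-subst vσ hσ h₂)

≼ᴴ-⟦⟧ : Value v → v ≼ᴴ w → t ≼ᴴ u → t ⟦ v ⟧ ≼ᴴ u ⟦ w ⟧
≼ᴴ-⟦⟧ vv h = ≼ᴴ-subst (single-value vv) λ { zero → h ; (suc x) → ≼ᴴ-refl (var x) }

-- By `≼`, `v` evaluates to an abstraction; as a value evaluates only to itself, `v` is that
-- abstraction.
≼ᴴ-lam⁻¹ : Value v → v ≼ᴴ lam u → ∃[ t ] v ≡ lam t × t ≼ᴴ u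
≼ᴴ-lam⁻¹ vv (lam p h) = _ , value-⇩ vv (≼-⇩ p (val (lam _))) , h

-- Induction on the evaluation of `u`. The term in the middle, such as `app t₁ t₂`, evaluates to a
-- value related to `w`, and the outer `≼` carries this very value over to `t`.
≼ᴴ-⇩ : t ≼ᴴ u → u ⇩ w → ∃[ v ] t ⇩ v × v ≼ᴴ w
≼ᴴ-⇩ (var p) (val vv) = _ , ≼-⇩ p (val vv) , ≼ᴴ-refl _
≼ᴴ-⇩ (lam p h) (val _) = _ , ≼-⇩ p (val (lam _)) , lam ≼-refl h
≼ᴴ-⇩ (app p h₁ h₂) (app d₁ d₂ d₃)
  with v₁ , e₁ , k₁ ← ≼ᴴ-⇩ h₁ d₁
  with t₁ , refl , k ← ≼ᴴ-lam⁻¹ (⇩-value e₁) k₁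
  with v₂ , e₂ , k₂ ← ≼ᴴ-⇩ h₂ d₂
  -- Substitutivity relates the two contracta, and `d₃` is a smaller evaluation.
  with v₃ , e₃ , k₃ ← ≼ᴴ-⇩ (≼ᴴ-⟦⟧ (⇩-value e₂) k₂ k) d₃
  = v₃ , ≼-⇩ p (app e₁ e₂ e₃) , k₃
≼ᴴ-⇩ (es p h₁ h₂) (es d₁ d₂)
  with v₁ , e₁ , k₁ ← ≼ᴴ-⇩ h₂ d₁
  with v₂ , e₂ , k₂ ← ≼ᴴ-⇩ (≼ᴴ-⟦⟧ (⇩-value e₁) k₁ h₁) d₂
  = v₂ , ≼-⇩ p (es e₁ e₂) , k₂

-- Completeness of evaluation for reduction in the VSC

⟶⇒≼ᴴ : t ⟶ t′ → t ≼ᴴ t′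
⟶⇒≼ᴴ (root r) = ≼⇒≼ᴴ (Root⇒≼ r)
⟶⇒≼ᴴ (lam r)  = lam ≼-refl (⟶⇒≼ᴴ r)
⟶⇒≼ᴴ (appˡ r) = app ≼-refl (⟶⇒≼ᴴ r) (≼ᴴ-refl _)
⟶⇒≼ᴴ (appʳ r) = app ≼-refl (≼ᴴ-refl _) (⟶⇒≼ᴴ r)
⟶⇒≼ᴴ (esˡ r)  = es ≼-refl (⟶⇒≼ᴴ r) (≼ᴴ-refl _)
⟶⇒≼ᴴ (esʳ r)  = es ≼-refl (≼ᴴ-refl _) (⟶⇒≼ᴴ r)

-- Evaluation is pulled back along the reduction from its final value. Each step may change the
-- resulting value, hence the existential.
⟶*⇒⇩ : {t v : Tm VSC} → Value v → t ⟶* v → ∃[ w ] t ⇩ w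
⟶*⇒⇩ vv ε        = _ , val vv
⟶*⇒⇩ vv (r ◅ rs) with w , d ← ⟶*⇒⇩ vv rs with w′ , d′ , _ ← ≼ᴴ-⇩ (⟶⇒≼ᴴ r) d = w′ , d′

⇓⇒⇩ : {t : Tm VSC} → t ⇓ → ∃[ w ] t ⇩ w
⇓⇒⇩ (v , vv , rs) = ⟶*⇒⇩ vv rs

-- The translations between the calculi

embed-rename : ∀ ρ t → embed (rename ρ t) ≡ rename ρ (embed t)
embed-rename ρ (var x)   = refl
embed-rename ρ (lam t)   = cong lam (embed-rename (lift ρ) t)
embed-rename ρ (app t u) = cong₂ app (embed-rename ρ t) (embed-rename ρ u)

embed-lifts : ∀ σ → embed ∘ lifts σ ≗ lifts (embed ∘ σ)
embed-lifts σ zero    = refl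
embed-lifts σ (suc x) = embed-rename suc (σ x)

embed-subst : ∀ σ t → embed (subst σ t) ≡ subst (embed ∘ σ) (embed t)
embed-subst σ (var x)   = refl
embed-subst σ (lam t)   = cong lam
  (trans (embed-subst (lifts σ) t) (subst-cong (embed-lifts σ) (embed t)))
embed-subst σ (app t u) = cong₂ app (embed-subst σ t) (embed-subst σ u)

embed-⟦⟧ : ∀ t u → embed (t ⟦ u ⟧) ≡ embed t ⟦ embed u ⟧
embed-⟦⟧ t u = trans (embed-subst (single u) t)
  (subst-cong (λ { zero → refl ; (suc x) → refl }) (embed t))

embed-value : Value v → Value (embed v)
embed-value (var x) = var x
embed-value (lam t) = lam _

embed-⟶ : t ⟶ t′ → embed t ⟶* embed t′
embed-⟶ (root (βᵥ {t} {v} vv)) =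
  transport (embed (app (lam t) v) ⟶*_) (sym (embed-⟦⟧ t v)) (β-⟶* (embed t) (embed-value vv))
embed-⟶ (lam r)  = gmap lam lam (embed-⟶ r)
embed-⟶ (appˡ r) = gmap (λ t → app t _) appˡ (embed-⟶ r)
embed-⟶ (appʳ r) = gmap (app _) appʳ (embed-⟶ r)

embed-⇓ : t ⇓ → embed t ⇓
embed-⇓ (v , vv , rs) = embed v , embed-value vv , kleisliStar embed embed-⟶ rs

⌊_⌋ : Tm VSC → Tm λPlot
⌊ var x ⌋   = var x
⌊ lam t ⌋   = lam ⌊ t ⌋
⌊ app t u ⌋ = app ⌊ t ⌋ ⌊ u ⌋
⌊ es t u ⌋  = app (lam ⌊ t ⌋) ⌊ u ⌋

⌊embed⌋ : ∀ t → ⌊ embed t ⌋ ≡ t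
⌊embed⌋ (var x)   = refl
⌊embed⌋ (lam t)   = cong lam (⌊embed⌋ t)
⌊embed⌋ (app t u) = cong₂ app (⌊embed⌋ t) (⌊embed⌋ u)

⌊⌋-rename : ∀ ρ t → ⌊ rename ρ t ⌋ ≡ rename ρ ⌊ t ⌋
⌊⌋-rename ρ (var x)   = refl
⌊⌋-rename ρ (lam t)   = cong lam (⌊⌋-rename (lift ρ) t)
⌊⌋-rename ρ (app t u) = cong₂ app (⌊⌋-rename ρ t) (⌊⌋-rename ρ u)
⌊⌋-rename ρ (es t u)  = cong₂ app (cong lam (⌊⌋-rename (lift ρ) t)) (⌊⌋-rename ρ u)

⌊⌋-lifts : ∀ σ → ⌊_⌋ ∘ lifts σ ≗ lifts (⌊_⌋ ∘ σ)
⌊⌋-lifts σ zero    = refl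
⌊⌋-lifts σ (suc x) = ⌊⌋-rename suc (σ x)

⌊⌋-subst : ∀ σ t → ⌊ subst σ t ⌋ ≡ subst (⌊_⌋ ∘ σ) ⌊ t ⌋
⌊⌋-subst σ (var x)   = refl
⌊⌋-subst σ (lam t)   = cong lam
  (trans (⌊⌋-subst (lifts σ) t) (subst-cong (⌊⌋-lifts σ) ⌊ t ⌋))
⌊⌋-subst σ (app t u) = cong₂ app (⌊⌋-subst σ t) (⌊⌋-subst σ u)
⌊⌋-subst σ (es t u)  = cong₂ app
  (cong lam (trans (⌊⌋-subst (lifts σ) t) (subst-cong (⌊⌋-lifts σ) ⌊ t ⌋)))
  (⌊⌋-subst σ u)

⌊⌋-⟦⟧ : ∀ t u → ⌊ t ⟦ u ⟧ ⌋ ≡ ⌊ t ⌋ ⟦ ⌊ u ⌋ ⟧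
⌊⌋-⟦⟧ t u = trans (⌊⌋-subst (single u) t)
  (subst-cong (λ { zero → refl ; (suc x) → refl }) ⌊ t ⌋)

⌊⌋-value : Value v → Value ⌊ v ⌋
⌊⌋-value (var x) = var x
⌊⌋-value (lam t) = lam _

⌊⌋-⇩ : t ⇩ v → ⌊ t ⌋ ⇩ ⌊ v ⌋
⌊⌋-⇩ (val vv) = val (⌊⌋-value vv)
⌊⌋-⇩ (app {b = b} {w = w} d₁ d₂ d₃) =
  app (⌊⌋-⇩ d₁) (⌊⌋-⇩ d₂) (transport (_⇩ _) (⌊⌋-⟦⟧ b w) (⌊⌋-⇩ d₃))
⌊⌋-⇩ (es {t = t} {w = w} d₁ d₂) =
  app (val (lam _)) (⌊⌋-⇩ d₁) (transport (_⇩ _) (⌊⌋-⟦⟧ t w) (⌊⌋-⇩ d₂))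

-- The two terms differ only at `es` nodes, where `es-≼-app` serves as the outer `≼` of the rule for
-- `app`.
≼ᴴ-embed⌊⌋ : ∀ t → t ≼ᴴ embed ⌊ t ⌋
≼ᴴ-embed⌊⌋ (var x)   = ≼ᴴ-refl (var x)
≼ᴴ-embed⌊⌋ (lam t)   = lam ≼-refl (≼ᴴ-embed⌊⌋ t)
≼ᴴ-embed⌊⌋ (app t u) = app ≼-refl (≼ᴴ-embed⌊⌋ t) (≼ᴴ-embed⌊⌋ u)
≼ᴴ-embed⌊⌋ (es t u)  = app es-≼-app (lam ≼-refl (≼ᴴ-embed⌊⌋ t)) (≼ᴴ-embed⌊⌋ u)

-- Root steps of the VSC with a nonempty `L` need not be matched by steps of `λPlot`, so the forward
-- direction passes through evaluation. Backwards, the reduction is first embedded in the VSC, where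
-- evaluation is complete, and then transferred by `≼ᴴ-embed⌊⌋`.
⌊⌋-⇓ : ∀ t → t ⇓ ⇔ ⌊ t ⌋ ⇓
⌊⌋-⇓ t = mk⇔ to from
  where
  to : t ⇓ → ⌊ t ⌋ ⇓
  to c with v , d ← ⇓⇒⇩ c = ⇩⇒⇓ (⌊⌋-⇩ d)
  from : ⌊ t ⌋ ⇓ → t ⇓
  from c with v , d ← ⇓⇒⇩ (embed-⇓ c) with w , d′ , _ ← ≼ᴴ-⇩ (≼ᴴ-embed⌊⌋ t) d = ⇩⇒⇓ d′

embed-⇓-⇔ : ∀ t → t ⇓ ⇔ embed t ⇓
embed-⇓-⇔ t = mk⇔ embed-⇓
  (transport _⇓ (⌊embed⌋ t) ∘ Equivalence.to (⌊⌋-⇓ (embed t)))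

-- Free variables and contexts under the translations

embed-∈fv⁻¹ : ∀ {x} t → x ∈fv embed t → x ∈fv t
embed-∈fv⁻¹ (var x)   var      = var
embed-∈fv⁻¹ (lam t)   (lam i)  = lam (embed-∈fv⁻¹ t i)
embed-∈fv⁻¹ (app t u) (appˡ i) = appˡ (embed-∈fv⁻¹ t i)
embed-∈fv⁻¹ (app t u) (appʳ i) = appʳ (embed-∈fv⁻¹ u i)

⌊⌋-∈fv⁻¹ : ∀ {x} t → x ∈fv ⌊ t ⌋ → x ∈fv t
⌊⌋-∈fv⁻¹ (var x)   var            = var
⌊⌋-∈fv⁻¹ (lam t)   (lam i)        = lam (⌊⌋-∈fv⁻¹ t i)
⌊⌋-∈fv⁻¹ (app t u) (appˡ i)       = appˡ (⌊⌋-∈fv⁻¹ t i)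
⌊⌋-∈fv⁻¹ (app t u) (appʳ i)       = appʳ (⌊⌋-∈fv⁻¹ u i)
⌊⌋-∈fv⁻¹ (es t u)  (appˡ (lam i)) = esˡ (⌊⌋-∈fv⁻¹ t i)
⌊⌋-∈fv⁻¹ (es t u)  (appʳ i)       = esʳ (⌊⌋-∈fv⁻¹ u i)

embedCtx : Ctx λPlot → Ctx VSC
embedCtx ∙          = ∙
embedCtx (lam x C)  = lam x (embedCtx C)
embedCtx (appˡ C u) = appˡ (embedCtx C) (embed u)
embedCtx (appʳ u C) = appʳ (embed u) (embedCtx C)

embed-⟨⟩ : ∀ C t → embed (C ⟨ t ⟩) ≡ embedCtx C ⟨ embed t ⟩
embed-⟨⟩ ∙          t = refl
embed-⟨⟩ (lam x C)  t = cong lam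
  (trans (embed-rename (bindVar x) (C ⟨ t ⟩)) (cong (bind x) (embed-⟨⟩ C t)))
embed-⟨⟩ (appˡ C u) t = cong (λ s → app s (embed u)) (embed-⟨⟩ C t)
embed-⟨⟩ (appʳ u C) t = cong (app (embed u)) (embed-⟨⟩ C t)

⌊_⌋Ctx : Ctx VSC → Ctx λPlot
⌊ ∙ ⌋Ctx         = ∙
⌊ lam x C ⌋Ctx   = lam x ⌊ C ⌋Ctx
⌊ appˡ C u ⌋Ctx  = appˡ ⌊ C ⌋Ctx ⌊ u ⌋
⌊ appʳ u C ⌋Ctx  = appʳ ⌊ u ⌋ ⌊ C ⌋Ctx
⌊ esˡ C x u ⌋Ctx = appˡ (lam x ⌊ C ⌋Ctx) ⌊ u ⌋
-- Here `x` scopes over `u` and not over the hole, so it is bound in a fixed abstraction instead of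
-- by a context `lam x`.
⌊ esʳ u x C ⌋Ctx = appʳ (lam (bind x ⌊ u ⌋)) ⌊ C ⌋Ctx

⌊⌋-⟨embed⟩ : ∀ C t → ⌊ C ⟨ embed t ⟩ ⌋ ≡ ⌊ C ⌋Ctx ⟨ t ⟩
⌊⌋-⟨embed⟩ ∙           t = ⌊embed⌋ t
⌊⌋-⟨embed⟩ (lam x C)   t = cong lam
  (trans (⌊⌋-rename (bindVar x) (C ⟨ embed t ⟩)) (cong (bind x) (⌊⌋-⟨embed⟩ C t)))
⌊⌋-⟨embed⟩ (appˡ C u)  t = cong (λ s → app s ⌊ u ⌋) (⌊⌋-⟨embed⟩ C t)
⌊⌋-⟨embed⟩ (appʳ u C)  t = cong (app ⌊ u ⌋) (⌊⌋-⟨embed⟩ C t)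
⌊⌋-⟨embed⟩ (esˡ C x u) t = cong (λ s → app (lam s) ⌊ u ⌋)
  (trans (⌊⌋-rename (bindVar x) (C ⟨ embed t ⟩)) (cong (bind x) (⌊⌋-⟨embed⟩ C t)))
⌊⌋-⟨embed⟩ (esʳ u x C) t =
  cong₂ (λ s → app (lam s)) (⌊⌋-rename (bindVar x) u) (⌊⌋-⟨embed⟩ C t)

embedCtx-⇓ : ∀ C t → (C ⟨ t ⟩) ⇓ ⇔ (embedCtx C ⟨ embed t ⟩) ⇓
embedCtx-⇓ C t = transport (λ s → (C ⟨ t ⟩) ⇓ ⇔ s ⇓) (embed-⟨⟩ C t) (embed-⇓-⇔ (C ⟨ t ⟩))

⌊⌋Ctx-⇓ : ∀ C t → (C ⟨ embed t ⟩) ⇓ ⇔ (⌊ C ⌋Ctx ⟨ t ⟩) ⇓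
⌊⌋Ctx-⇓ C t =
  transport (λ s → (C ⟨ embed t ⟩) ⇓ ⇔ s ⇓) (⌊⌋-⟨embed⟩ C t) (⌊⌋-⇓ (C ⟨ embed t ⟩))

embedCtx-closed : ∀ C t → Closed (C ⟨ t ⟩) → Closed (embedCtx C ⟨ embed t ⟩)
embedCtx-closed C t cl = transport Closed (embed-⟨⟩ C t)
  λ x → cl x ∘ embed-∈fv⁻¹ (C ⟨ t ⟩)

⌊⌋Ctx-closed : ∀ C t → Closed (C ⟨ embed t ⟩) → Closed (⌊ C ⌋Ctx ⟨ t ⟩)
⌊⌋Ctx-closed C t cl = transport Closed (⌊⌋-⟨embed⟩ C t)
  λ x → cl x ∘ ⌊⌋-∈fv⁻¹ (C ⟨ embed t ⟩)

proposition4p6 : (t u : Tm λPlot) → CtxEquiv λPlot t u ⇔ CtxEquiv VSC (embed t) (embed u)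
proposition4p6 t u = mk⇔
  -- A VSC context is replaced by its unfolding, which converges on the same terms.
  (λ t≃u C clₜ clᵤ → ⇔.trans (⌊⌋Ctx-⇓ C t)
    (⇔.trans (t≃u ⌊ C ⌋Ctx (⌊⌋Ctx-closed C t clₜ) (⌊⌋Ctx-closed C u clᵤ))
             (⇔.sym (⌊⌋Ctx-⇓ C u))))
  -- A context of `λPlot` is tested through its embedding in the VSC.
  (λ t≃u C clₜ clᵤ → ⇔.trans (embedCtx-⇓ C t)
    (⇔.trans (t≃u (embedCtx C) (embedCtx-closed C t clₜ) (embedCtx-closed C u clᵤ))
             (⇔.sym (embedCtx-⇓ C u))))
  where module ⇔ = Setoid (⇔-setoid 0ℓ)
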